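{- Let $r\ge 2$ and let $F$ be an $r$-graph such that $\gamma^+(F)>0$. Then $\gamma^+(F)\ge 1/r$.
   Context: An $r$-graph is a finite $r$-uniform hypergraph. The minimum positive co-degree $\delta_{r-1}^+(H)$ of a non-empty $r$-graph $H$ is the maximum $k$ such that every $(r-1)$-set of vertices contained in some edge of $H$ is contained in at least $k$ distinct edges of $H$; by convention it is $0$ if $H$ has no edges. A hypergraph is $F$-free if it has no (not necessarily induced) subhypergraph isomorphic to $F$. $\mathrm{co^+ex}(n,F)$ is the maximum of $\delta_{r-1}^+(H)$ over all $n$-vertex $F$-free $r$-graphs $H$ (taken to be $0$ if there are none), and $\gamma^+(F)=\lim_{n\to\infty}\mathrm{co^+ex}(n,F)/n$ (this limit exists). -}

module Defs where

open import Data.Bool using (Bool; true; false; T; T?)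
open import Data.Fin using (Fin; zero; suc)
import Data.Fin.Properties as Fin
open import Data.Fin.Subset using (Subset; inside; outside; _∈_; _⊆_; ∣_∣)
open import Data.Fin.Subset.Properties using (_∈?_; _⊆?_; anySubset?; ⊆-refl; out⊆; s⊆s)
open import Data.Integer using (+_)
open import Data.List as List using (List; []; _∷_; _++_; length; filter)
open import Data.List.Properties using (length-filter; filter-≐)
open import Data.Nat using (ℕ; zero; suc; _≤_; _≥_; _∸_; z≤n; s≤s; _≤?_; _≟_)
import Data.Nat.Properties as ℕ
open import Data.Product using (∃; _×_; _,_; proj₁; proj₂)
open import Data.Rational as ℚ using (ℚ; 0ℚ)
import Data.Rational.Properties as ℚ
open import Data.Sum using (_⊎_; inj₁; inj₂)
open import Data.Vec using ([]; _∷_; tabulate)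
open import Data.Vec.Properties using (tabulate-cong)
open import Function using (_∘_; const)
open import Function.Definitions using (Injective)
open import Level using (0ℓ)
open import Relation.Binary.PropositionalEquality
  using (_≡_; refl; sym; trans; cong; subst; _≗_)
open import Relation.Nullary using (¬_; Dec; yes; no; does; contradiction)
open import Relation.Nullary.Decidable
  using (map′; _×-dec_; _⊎-dec_; _→-dec_; ¬?; decidable-stable; does-≡)
open import Relation.Unary using (Pred; Decidable)

record ℝ : Set where
  field
    seq    : ℕ → ℚ
    cauchy : ∀ ε → 0ℚ ℚ.< ε →
             ∃ λ N → ∀ m n → m ≥ N → n ≥ N → ℚ.∣ seq m ℚ.- seq n ∣ ℚ.< ε

infix 4 _<ℝ_ _≤ℝ_

_<ℝ_ : ℝ → ℝ → Set
x <ℝ y = ∃ λ ε → 0ℚ ℚ.< ε ×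
         ∃ λ N → ∀ n → n ≥ N → ℝ.seq x n ℚ.+ ε ℚ.≤ ℝ.seq y n

_≤ℝ_ : ℝ → ℝ → Set
x ≤ℝ y = ¬ (y <ℝ x)

fromℚ : ℚ → ℝ
fromℚ q = record
  { seq    = const q
  ; cauchy = λ ε 0<ε → 0 , λ _ _ _ _ →
      subst (ℚ._< ε) (sym (cong ℚ.∣_∣ (ℚ.+-inverseʳ q))) 0<ε
  }

0ℝ : ℝ
0ℝ = fromℚ 0ℚ

-- ∣ a n - x ∣ < ε is spelled out as a n - ε < x < a n + ε.
_ConvergesTo_ : (ℕ → ℚ) → ℝ → Set
a ConvergesTo x = ∀ ε → 0ℚ ℚ.< ε → ∃ λ N → ∀ n → n ≥ N →
  fromℚ (a n ℚ.- ε) <ℝ x × x <ℝ fromℚ (a n ℚ.+ ε)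

-- The value at n = 0 is a convention; it does not affect limits as n → ∞.
_÷_ : ℕ → ℕ → ℚ
k ÷ zero  = 0ℚ
k ÷ suc n = + k ℚ./ suc n

IsMaximum : Pred ℕ 0ℓ → ℕ → Set
IsMaximum P k = P k × (∀ j → P j → j ≤ k)

private
  bounded-maximum : ∀ {P : Pred ℕ 0ℓ} → Decidable P →
                    ∀ b → (∀ j → P j → j ≤ b) → ∃ P → ∃ (IsMaximum P)
  bounded-maximum P? b ub ∃P with P? b
  bounded-maximum P? b ub ∃P | yes Pb = b , Pb , ub
  bounded-maximum {P} P? zero ub (k , Pk) | no ¬P0 =
    contradiction (subst P (ℕ.n≤0⇒n≡0 (ub k Pk)) Pk) ¬P0
  bounded-maximum {P} P? (suc b) ub ∃P | no ¬Pb = bounded-maximum P? b ub′ ∃P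
    where
    ub′ : ∀ j → P j → j ≤ b
    ub′ j Pj = ℕ.≤-pred (ℕ.≤∧≢⇒< (ub j Pj) λ { refl → ¬Pb Pj })

record RGraph (r n : ℕ) : Set where
  field
    isEdge  : Subset n → Bool
    uniform : ∀ e → T (isEdge e) → ∣ e ∣ ≡ r

  Edge : Subset n → Set
  Edge e = T (isEdge e)

  Edge? : Decidable Edge
  Edge? e = T? (isEdge e)

open RGraph using (Edge; Edge?)

image : ∀ {m n} → (Fin m → Fin n) → Subset m → Subset n
image f e = tabulate λ j → does (Fin.any? λ i → (i ∈? e) ×-dec (f i Fin.≟ j))

-- H has a (not necessarily induced) subhypergraph isomorphic to F, with
-- vertices f i and edges image f e.
_Contains_ : ∀ {r n v} → RGraph r n → RGraph r v → Set
_Contains_ {n = n} {v} H F = ∃ λ (f : Fin v → Fin n) →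
  Injective _≡_ _≡_ f × (∀ e → Edge F e → Edge H (image f e))

_IsFree_ : ∀ {r n v} → RGraph r n → RGraph r v → Set
H IsFree F = ¬ (H Contains F)

allSubsets : ∀ n → List (Subset n)
allSubsets zero    = [] ∷ []
allSubsets (suc n) = List.map (inside ∷_) (allSubsets n) ++
                     List.map (outside ∷_) (allSubsets n)

degree : ∀ {r n} → RGraph r n → Subset n → ℕ
degree {n = n} H S =
  length (filter (λ e → Edge? H e ×-dec (S ⊆? e)) (allSubsets n))

MinPositiveCodegree≥ : ∀ {r n} → RGraph r n → ℕ → Set
MinPositiveCodegree≥ {r} H k =
  ∀ S → ∣ S ∣ ≡ r ∸ 1 → (∃ λ e → Edge H e × S ⊆ e) → k ≤ degree H S

IsMinPositiveCodegree : ∀ {r n} → RGraph r n → ℕ → Set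
IsMinPositiveCodegree H k =
    (∃ (Edge H)     × IsMaximum (MinPositiveCodegree≥ H) k)
  ⊎ ((¬ ∃ (Edge H)) × k ≡ 0)

private
  allSubset? : ∀ {n} {P : Pred (Subset n) 0ℓ} → Decidable P → Dec (∀ S → P S)
  allSubset? P? = map′
    (λ ¬∃¬ S → decidable-stable (P? S) λ ¬PS → ¬∃¬ (S , ¬PS))
    (λ { ∀P (S , ¬PS) → ¬PS (∀P S) })
    (¬? (anySubset? (¬? ∘ P?)))

  drop-one : ∀ {n} (e : Subset n) → ∃ λ S → ∣ S ∣ ≡ ∣ e ∣ ∸ 1 × S ⊆ e
  drop-one []            = [] , refl , λ ()
  drop-one (inside  ∷ e) = outside ∷ e , refl , out⊆ ⊆-refl
  drop-one (outside ∷ e) with drop-one e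
  ... | S , ∣S∣ , S⊆e = outside ∷ S , ∣S∣ , s⊆s S⊆e

  MinPositiveCodegree≥? : ∀ {r n} (H : RGraph r n) →
                          Decidable (MinPositiveCodegree≥ H)
  MinPositiveCodegree≥? {r} H k = allSubset? λ S →
    (∣ S ∣ ≟ r ∸ 1) →-dec
    (anySubset? (λ e → Edge? H e ×-dec (S ⊆? e)) →-dec (k ≤? degree H S))

  MinPositiveCodegree≥-bounded :
    ∀ {r n} (H : RGraph r n) → ∃ (Edge H) →
    ∀ k → MinPositiveCodegree≥ H k → k ≤ length (allSubsets n)
  MinPositiveCodegree≥-bounded {r} {n} H (e , He) k k≤ with drop-one e
  ... | S , ∣S∣ , S⊆e = ℕ.≤-trans
    (k≤ S (trans ∣S∣ (cong (_∸ 1) (RGraph.uniform H e He))) (e , He , S⊆e))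
    (length-filter (λ e → Edge? H e ×-dec (S ⊆? e)) (allSubsets n))

∃-minPositiveCodegree : ∀ {r n} (H : RGraph r n) → ∃ (IsMinPositiveCodegree H)
∃-minPositiveCodegree {n = n} H with anySubset? (Edge? H)
... | no ¬∃e = 0 , inj₂ (¬∃e , refl)
... | yes ∃e with bounded-maximum (MinPositiveCodegree≥? H)
                    (length (allSubsets n)) (MinPositiveCodegree≥-bounded H ∃e)
                    (0 , λ _ _ _ → z≤n)
...   | k , max = k , inj₁ (∃e , max)

δ⁺ : ∀ {r n} → RGraph r n → ℕ
δ⁺ H = proj₁ (∃-minPositiveCodegree H)

IsCo⁺ex : ∀ {r v} → ℕ → RGraph r v → ℕ → Set
IsCo⁺ex {r} n F k =
    IsMaximum (λ j → ∃ λ (H : RGraph r n) → H IsFree F × δ⁺ H ≡ j) k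
  ⊎ ((∀ (H : RGraph r n) → ¬ (H IsFree F)) × k ≡ 0)

private
  -- Without function extensionality, searching through functions needs the
  -- predicate to respect pointwise equality.
  anyFamily? : ∀ n (P : Pred (Subset n → Bool) 0ℓ) →
               (∀ {E E′} → E ≗ E′ → P E → P E′) → Decidable P → Dec (∃ P)
  anyFamily? zero P resp P? = map′
    (λ { (inj₁ p) → const true , p ; (inj₂ p) → const false , p })
    (λ { (E , p) → split E p (E []) refl })
    (P? (const true) ⊎-dec P? (const false))
    where
    split : ∀ E → P E → ∀ b → E [] ≡ b → P (const true) ⊎ P (const false)
    split E p true  eq = inj₁ (resp (λ { [] → eq }) p)
    split E p false eq = inj₂ (resp (λ { [] → eq }) p)
  anyFamily? (suc n) P resp P? = map′
    (λ { (E , E′ , p) → join E E′ , p })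
    (λ { (E , p) → E ∘ (inside ∷_) , E ∘ (outside ∷_) , resp (split E) p })
    (anyFamily? n (λ E → ∃ λ E′ → P (join E E′))
      (λ { eq (E′ , p) → E′ , resp (join-cong eq (λ _ → refl)) p })
      λ E → anyFamily? n (λ E′ → P (join E E′))
        (λ eq p → resp (join-cong (λ _ → refl) eq) p)
        λ E′ → P? (join E E′))
    where
    join : (Subset n → Bool) → (Subset n → Bool) → Subset (suc n) → Bool
    join E E′ (inside  ∷ S) = E S
    join E E′ (outside ∷ S) = E′ S
    split : ∀ E → E ≗ join (E ∘ (inside ∷_)) (E ∘ (outside ∷_))
    split E (inside  ∷ S) = refl
    split E (outside ∷ S) = refl
    join-cong : ∀ {E E′ G G′} → E ≗ G → E′ ≗ G′ → join E E′ ≗ join G G′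
    join-cong p q (inside  ∷ S) = p S
    join-cong p q (outside ∷ S) = q S

  anyMap? : ∀ v {n} (P : Pred (Fin v → Fin n) 0ℓ) →
            (∀ {f g} → f ≗ g → P f → P g) → Decidable P → Dec (∃ P)
  anyMap? zero P resp P? = map′
    (λ p → none , p) (λ { (f , p) → resp (λ ()) p }) (P? none)
    where
    none : Fin zero → Fin _
    none ()
  anyMap? (suc v) {n} P resp P? = map′
    (λ { (x , f , p) → cons x f , p })
    (λ { (f , p) → f zero , f ∘ suc , resp (split f) p })
    (Fin.any? λ x → anyMap? v (λ f → P (cons x f))
      (λ eq p → resp (cons-cong eq) p) λ f → P? (cons x f))
    where
    cons : Fin n → (Fin v → Fin n) → Fin (suc v) → Fin n
    cons x f zero    = x
    cons x f (suc i) = f i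
    split : ∀ f → f ≗ cons (f zero) (f ∘ suc)
    split f zero    = refl
    split f (suc i) = refl
    cons-cong : ∀ {x f g} → f ≗ g → cons x f ≗ cons x g
    cons-cong eq zero    = refl
    cons-cong eq (suc i) = eq i

  image-cong : ∀ {m n} {f g : Fin m → Fin n} → f ≗ g → image f ≗ image g
  image-cong {f = f} {g} f≗g e = tabulate-cong λ j →
    does-≡ (Fin.any? λ i → (i ∈? e) ×-dec (f i Fin.≟ j))
      (map′ (λ { (i , i∈e , eq) → i , i∈e , trans (f≗g i) eq })
            (λ { (i , i∈e , eq) → i , i∈e , trans (sym (f≗g i)) eq })
            (Fin.any? λ i → (i ∈? e) ×-dec (g i Fin.≟ j)))

  contains? : ∀ {r n v} (H : RGraph r n) (F : RGraph r v) → Dec (H Contains F)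
  contains? {v = v} H F = anyMap? v _
    (λ { eq (inj , hom) →
           (λ {i} {j} gi≡gj → inj (trans (eq i) (trans gi≡gj (sym (eq j)))))
         , (λ e Fe → subst (Edge H) (image-cong eq e) (hom e Fe)) })
    λ f → map′ (λ inj {i} {j} → inj i j) (λ inj i j → inj {i} {j})
               (Fin.all? λ i → Fin.all? λ j →
                 (f i Fin.≟ f j) →-dec (i Fin.≟ j))
          ×-dec allSubset? λ e → Edge? F e →-dec Edge? H (image f e)

  module _ {r n} (H H′ : RGraph r n) (eq : RGraph.isEdge H ≗ RGraph.isEdge H′) where

    Edge-resp : ∀ {e} → Edge H e → Edge H′ e
    Edge-resp {e} = subst T (eq e)

    Edge-resp⁻¹ : ∀ {e} → Edge H′ e → Edge H e
    Edge-resp⁻¹ {e} = subst T (sym (eq e))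

    Contains-resp : ∀ {v} {F : RGraph r v} → H Contains F → H′ Contains F
    Contains-resp (f , inj , hom) = f , inj , λ e Fe → Edge-resp (hom e Fe)

    degree-resp : ∀ S → degree H S ≡ degree H′ S
    degree-resp S = cong length (filter-≐
      (λ e → Edge? H e ×-dec (S ⊆? e)) (λ e → Edge? H′ e ×-dec (S ⊆? e))
      ( (λ { (He , S⊆e) → Edge-resp He , λ {x} → S⊆e {x} })
      , (λ { (He , S⊆e) → Edge-resp⁻¹ He , λ {x} → S⊆e {x} }))
      (allSubsets n))

    codegree-resp : ∀ {k} → MinPositiveCodegree≥ H k → MinPositiveCodegree≥ H′ k
    codegree-resp k≤ S ∣S∣ (e , H′e , S⊆e) =
      subst (_ ≤_) (degree-resp S) (k≤ S ∣S∣ (e , Edge-resp⁻¹ H′e , S⊆e))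

  δ⁺-resp : ∀ {r n} (H H′ : RGraph r n) →
            RGraph.isEdge H ≗ RGraph.isEdge H′ → δ⁺ H ≡ δ⁺ H′
  δ⁺-resp H H′ eq with ∃-minPositiveCodegree H | ∃-minPositiveCodegree H′
  ... | _ , inj₂ (_ , refl)       | _ , inj₂ (_ , refl) = refl
  ... | _ , inj₁ ((e , He) , _)   | _ , inj₂ (¬∃ , _)   =
    contradiction (e , Edge-resp H H′ eq He) ¬∃
  ... | _ , inj₂ (¬∃ , _)         | _ , inj₁ ((e , He) , _) =
    contradiction (e , Edge-resp⁻¹ H H′ eq He) ¬∃
  ... | k , inj₁ (_ , k≤ , max)   | k′ , inj₁ (_ , k′≤ , max′) = ℕ.≤-antisym
    (max′ k (codegree-resp H H′ eq k≤))
    (max k′ (codegree-resp H′ H (sym ∘ eq) k′≤))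

  anyGraph? : ∀ {r n} (P : Pred (RGraph r n) 0ℓ) →
              (∀ {H H′} → RGraph.isEdge H ≗ RGraph.isEdge H′ → P H → P H′) →
              Decidable P → Dec (∃ P)
  anyGraph? {r} {n} P resp P? = map′
    (λ { (E , u , p) → record { isEdge = E ; uniform = u } , p })
    (λ { (H , p) → RGraph.isEdge H , RGraph.uniform H , p })
    (anyFamily? n Q
      (λ { eq (u , p) → (λ e → u e ∘ subst T (sym (eq e))) , resp eq p }) Q?)
    where
    Q : Pred (Subset n → Bool) 0ℓ
    Q E = ∃ λ (u : ∀ e → T (E e) → ∣ e ∣ ≡ r) → P record { isEdge = E ; uniform = u }
    Q? : Decidable Q
    Q? E with allSubset? (λ e → T? (E e) →-dec (∣ e ∣ ≟ r))
    ... | no ¬u = no (¬u ∘ proj₁)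
    ... | yes u = map′ (u ,_) (λ { (_ , p) → resp (λ _ → refl) p }) (P? _)

  δ⁺-bounded : ∀ {r n} (H : RGraph r n) → δ⁺ H ≤ length (allSubsets n)
  δ⁺-bounded H with ∃-minPositiveCodegree H
  ... | _ , inj₂ (_ , refl)    = z≤n
  ... | k , inj₁ (∃e , k≤ , _) = MinPositiveCodegree≥-bounded H ∃e k k≤

∃-co⁺ex : ∀ {r v} n (F : RGraph r v) → ∃ (IsCo⁺ex n F)
∃-co⁺ex {r} n F with anyGraph? {r} {n} (_IsFree F)
                       (λ { {H} {H′} eq free → free ∘ Contains-resp H′ H (sym ∘ eq) {F = F} })
                       (λ H → ¬? (contains? H F))
... | no ¬∃H = 0 , inj₂ ((λ H free → ¬∃H (H , free)) , refl)
... | yes (H , free) with bounded-maximum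
        (λ j → anyGraph? (λ (H : RGraph r n) → H IsFree F × δ⁺ H ≡ j)
          (λ { {H} {H′} eq (free , δ≡) →
                 (free ∘ Contains-resp H′ H (sym ∘ eq) {F = F})
               , trans (sym (δ⁺-resp H H′ eq)) δ≡ })
          (λ H → ¬? (contains? H F) ×-dec (δ⁺ H ≟ j)))
        (length (allSubsets n))
        (λ { _ (H , _ , refl) → δ⁺-bounded H })
        (δ⁺ H , H , free , refl)
...   | k , max = k , inj₁ max

co⁺ex : ∀ {r v} → ℕ → RGraph r v → ℕ
co⁺ex n F = proj₁ (∃-co⁺ex n F)

-- γ⁺(F) = γ.  A relation rather than a function of F, because γ⁺(F) is a limit
-- and its existence is not proved here.
IsPositiveCodegreeDensity : ∀ {r v} → RGraph r v → ℝ → Set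
IsPositiveCodegreeDensity F γ = (λ n → co⁺ex n F ÷ n) ConvergesTo γ

{-# OPTIONS --safe #-}

-- If F is not r-partite, the complete r-partite r-graph with parts of size m is
-- F-free on r m vertices and has minimum positive codegree m, so γ⁺(F) ≥ 1/r.
-- If F is r-partite, then γ⁺(F) = 0: an r-graph on n vertices with an edge and
-- minimum positive codegree ≥ n/q has at least (n/q)ʳ ordered edges, because the
-- vertices of an edge can be replaced one after the other in n/q ways each, and
-- by Erdős' theorem such a dense r-graph contains, for large n, every complete
-- r-partite r-graph of fixed size.
module Submission where

open import Defs
open import Data.Bool using (Bool; true; false; T; _∧_; not; if_then_else_)
open import Data.Bool.Properties using (∧-comm; ∧-assoc; T-∧)
open import Data.Fin using (Fin; zero; suc; punchOut; remQuot; combine)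
import Data.Fin.Properties as Fin
open import Data.Fin.Subset using (Subset; inside; outside; _∈_; _∉_; _⊆_; ∣_∣; ⁅_⁆; _∪_; ⊥)
open import Data.Fin.Subset.Properties
  using (_∈?_; _⊆?_; drop-there; drop-∷-⊆; ⊆-antisym; ∉⊥; ∣⊥∣≡0; x∈⁅x⁆; x∈⁅y⁆⇒x≡y; p⊆p∪q; q⊆p∪q;
         x∈p∪q⁻; p⊆q⇒∣p∣≤∣q∣; p⊂q⇒∣p∣<∣q∣; ∪-assoc; ∪-comm; ∪-identityˡ; ∪-identityʳ)
import Data.Integer as ℤ
import Data.Integer.Properties as ℤ
open import Data.List as List using (List; length; filter)
open import Data.List.Membership.Propositional using () renaming (_∈_ to _∈ˡ_)
open import Data.List.Membership.Propositional.Properties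
  using (∈-lookup; ∈-map⁺; ∈-map⁻; ∈-++⁺ˡ; ∈-++⁺ʳ; ∈-filter⁺; ∈-filter⁻)
open import Data.List.Membership.Setoid.Properties using (index-injective)
open import Data.List.Relation.Unary.All as All using ([])
open import Data.List.Relation.Unary.AllPairs using ([]; _∷_)
open import Data.List.Relation.Unary.Any using (here; index)
open import Data.List.Relation.Unary.Unique.Propositional using (Unique)
import Data.List.Relation.Unary.Unique.Propositional.Properties as Unique
open import Data.Nat
  using (ℕ; zero; suc; _+_; _*_; _^_; _∸_; _⊔_; _≤_; _<_; z≤n; s≤s; _≟_; _≤?_; _<?_; NonZero; >-nonZero)
import Data.Nat.Properties as ℕ
open import Data.Nat.Tactic.RingSolver using (solve-∀)
open import Data.Product using (∃; _×_; _,_; proj₁; proj₂)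
open import Data.Rational as ℚ using (ℚ; 0ℚ; mkℚ)
import Data.Rational.Properties as ℚ
open import Data.Rational.Unnormalised as ℚᵘ using (mkℚᵘ)
import Data.Rational.Unnormalised.Properties as ℚᵘ
open import Data.Sum using (_⊎_; inj₁; inj₂)
open import Data.Unit using (tt)
open import Data.Vec as Vec using (Vec; []; _∷_; tabulate)
open import Data.Vec.Properties using (lookup∘tabulate; []=⇒lookup; lookup⇒[]=)
open import Function using (_∘_; const; Equivalence)
open import Function.Definitions using (Injective)
open import Relation.Binary.PropositionalEquality
  using (_≡_; _≢_; _≗_; refl; sym; trans; cong; cong₂; subst; subst₂; setoid)
open import Relation.Nullary using (¬_; Dec; yes; no; isYes; contradiction)
open import Relation.Nullary.Decidable using (_×-dec_; _→-dec_; toWitness; fromWitness; dec-true)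
open import Algebra.Properties.Semiring.Sum ℕ.+-*-semiring
  using (sum; sum-cong-≗; ∑-distrib-+; *-distribˡ-sum; sum-remove)
open RGraph using (isEdge; uniform; Edge; Edge?)

-- Sums over finite index sets and averaging.

sum-mono : ∀ {n} {f g : Fin n → ℕ} → (∀ i → f i ≤ g i) → sum f ≤ sum g
sum-mono {zero}  f≤g = z≤n
sum-mono {suc n} f≤g = ℕ.+-mono-≤ (f≤g zero) (sum-mono (f≤g ∘ suc))

sum-const : ∀ n c → sum {n} (const c) ≡ n * c
sum-const zero    c = refl
sum-const (suc n) c = cong (c +_) (sum-const n c)

cons-injective : ∀ {m n} {g : Fin m → Fin n} → Injective _≡_ _≡_ g →
  ∃ λ (g′ : Fin (suc m) → Fin (suc n)) →
    Injective _≡_ _≡_ g′ × g′ zero ≡ zero × ∀ i → g′ (suc i) ≡ suc (g i)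
cons-injective {g = g} g-inj = g′ , g′-inj , refl , λ _ → refl
  where
  g′ : Fin _ → Fin _
  g′ zero    = zero
  g′ (suc i) = suc (g i)
  g′-inj : Injective _≡_ _≡_ g′
  g′-inj {zero}  {zero}  _  = refl
  g′-inj {zero}  {suc j} ()
  g′-inj {suc i} {zero}  ()
  g′-inj {suc i} {suc j} eq = cong suc (g-inj (Fin.suc-injective eq))

-- Averaging: if fewer than `M` indices reach the value `d`, those indices contribute at most
-- `M * N` and all the others at most `n * d`.
many-large : ∀ {n} (h : Fin n → ℕ) N d → (∀ x → h x ≤ N) → ∀ M →
  (∃ λ (g : Fin M → Fin n) → Injective _≡_ _≡_ g × ∀ i → d ≤ h (g i))
  ⊎ sum h ≤ M * N + n * d
many-large h N d h≤N zero = inj₁ ((λ ()) , (λ { {()} }) , λ ())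
many-large {zero} h N d h≤N (suc M) = inj₂ z≤n
many-large {suc n} h N d h≤N (suc M) with d ≤? h zero
... | yes d≤h₀ with many-large (h ∘ suc) N d (h≤N ∘ suc) M
...   | inj₂ few = inj₂ (begin
  h zero + sum (h ∘ suc)     ≤⟨ ℕ.+-mono-≤ (h≤N zero) few ⟩
  N + (M * N + n * d)        ≡⟨ ℕ.+-assoc N _ _ ⟨
  suc M * N + n * d          ≤⟨ ℕ.+-monoʳ-≤ (suc M * N) (ℕ.m≤n+m (n * d) d) ⟩
  suc M * N + suc n * d      ∎)
  where open ℕ.≤-Reasoning
...   | inj₁ (g , g-inj , large) with cons-injective g-inj
...     | g′ , g′-inj , eq₀ , eqₛ = inj₁ (g′ , g′-inj , λ
  { zero    → subst (λ x → d ≤ h x) (sym eq₀) d≤h₀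
  ; (suc i) → subst (λ x → d ≤ h x) (sym (eqₛ i)) (large i) })
many-large {suc n} h N d h≤N (suc M) | no d≰h₀
  with many-large (h ∘ suc) N d (h≤N ∘ suc) (suc M)
... | inj₁ (g , g-inj , large) = inj₁ (suc ∘ g , g-inj ∘ Fin.suc-injective , large)
... | inj₂ few = inj₂ (begin
  h zero + sum (h ∘ suc)      ≤⟨ ℕ.+-mono-≤ (ℕ.≰⇒≥ d≰h₀) few ⟩
  d + (suc M * N + n * d)     ≡⟨ swap d (suc M * N) (n * d) ⟩
  suc M * N + suc n * d       ∎)
  where
  open ℕ.≤-Reasoning
  swap : ∀ a b c → a + (b + c) ≡ b + (a + c)
  swap = solve-∀

-- Dense families of ordered tuples and Erdős' theorem.

count : ∀ {n} r → (Vec (Fin n) r → Bool) → ℕ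
count zero    E = if E [] then 1 else 0
count (suc r) E = sum λ x → count r (E ∘ (x ∷_))

count-cong : ∀ {n} r {E E′ : Vec (Fin n) r → Bool} → E ≗ E′ → count r E ≡ count r E′
count-cong zero    eq = cong (if_then 1 else 0) (eq [])
count-cong (suc r) eq = sum-cong-≗ λ x → count-cong r (eq ∘ (x ∷_))

count-split : ∀ {n} r (E A : Vec (Fin n) r → Bool) →
  count r E ≡ count r (λ v → E v ∧ A v) + count r (λ v → E v ∧ not (A v))
count-split zero E A with E [] | A []
... | false | _     = refl
... | true  | false = refl
... | true  | true  = refl
count-split (suc r) E A = trans
  (sum-cong-≗ λ x → count-split r (E ∘ (x ∷_)) (A ∘ (x ∷_)))
  (∑-distrib-+ (λ x → count r (λ v → E (x ∷ v) ∧ A (x ∷ v))) _)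

count-∧ : ∀ {n} r (E A : Vec (Fin n) r → Bool) → count r (λ v → E v ∧ A v) ≤ count r E
count-∧ r E A = ℕ.≤-trans (ℕ.m≤m+n _ _) (ℕ.≤-reflexive (sym (count-split r E A)))

count-true : ∀ n r → count {n} r (const true) ≡ n ^ r
count-true n zero    = refl
count-true n (suc r) = trans (sum-cong-≗ {n} λ _ → count-true n r) (sum-const n (n ^ r))

count-≤ : ∀ {n} r (E : Vec (Fin n) r → Bool) → count r E ≤ n ^ r
count-≤ {n} r E = subst (count r E ≤_) (count-true n r) (count-∧ r (const true) E)

-- This is the binomial coefficient `M` choose `t + 1`, built by Pascal's rule. It suits the error
-- term because a point lying in d of the sets satisfies d ≤ t + (d choose t + 1), and an
-- intersection of `t + 1` sets is no larger than that of `t` of them.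
slack : ℕ → ℕ → ℕ
slack M       zero    = M
slack zero    (suc t) = 0
slack (suc M) (suc t) = slack M t + slack M (suc t)

-- The part of B inside the first set needs t - 1 further sets and the part
-- outside needs t, which is the recursion of slack.
dense-intersection : ∀ {n r M} (A : Fin M → Vec (Fin n) r → Bool) t B K N →
  (∃ λ (g : Fin t → Fin M) → Injective _≡_ _≡_ g ×
   ∃ λ C → (∀ v → T (C v) → T (B v) × ∀ i → T (A (g i) v)) × N < K * count r C)
  ⊎ K * sum (λ m → count r (λ v → B v ∧ A m v)) ≤ K * (t * count r B) + slack M t * N
dense-intersection {r = r} {M} A zero B K N with N <? K * count r B
-- The intersection of no sets is `B` itself. If it has at most `N / K` tuples, so has each of the
-- `M` terms; `K` and `N` are kept apart to avoid division.
... | yes N< = inj₁ ((λ ()) , (λ { {()} }) , B , (λ v Bv → Bv , λ ()) , N<)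
... | no N≮ = inj₂ (begin
  K * sum (λ m → count r (λ v → B v ∧ A m v))  ≤⟨ ℕ.*-monoʳ-≤ K (sum-mono λ m → count-∧ r B (A m)) ⟩
  K * sum {M} (const (count r B))              ≡⟨ cong (K *_) (sum-const M (count r B)) ⟩
  K * (M * count r B)                          ≡⟨ swap K M (count r B) ⟩
  M * (K * count r B)                          ≤⟨ ℕ.*-monoʳ-≤ M (ℕ.≮⇒≥ N≮) ⟩
  M * N                                        ≡⟨ cong (_+ M * N) (ℕ.*-zeroʳ K) ⟨
  K * 0 + M * N                                ∎)
  where
  open ℕ.≤-Reasoning
  swap : ∀ a b c → a * (b * c) ≡ b * (a * c)
  swap = solve-∀
dense-intersection {M = zero} A (suc t) B K N = inj₂ (ℕ.≤-trans (ℕ.≤-reflexive (ℕ.*-zeroʳ K)) z≤n)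
dense-intersection {r = r} {suc M} A (suc t) B K N
  with dense-intersection (A ∘ suc) t (λ v → B v ∧ A zero v) K N
     | dense-intersection (A ∘ suc) (suc t) (λ v → B v ∧ not (A zero v)) K N
... | inj₁ (g , g-inj , C , C⊆ , N<) | _ with cons-injective g-inj
...   | g′ , g′-inj , eq₀ , eqₛ = inj₁ (g′ , g′-inj , C , C⊆′ , N<)
  where
  C⊆′ : ∀ v → T (C v) → T (B v) × ∀ i → T (A (g′ i) v)
  C⊆′ v Cv with C⊆ v Cv
  ... | BA₀v , Av with Equivalence.to T-∧ BA₀v
  ...   | Bv , A₀v = Bv , λ
    { zero    → subst (λ x → T (A x v)) (sym eq₀) A₀v
    ; (suc i) → subst (λ x → T (A x v)) (sym (eqₛ i)) (Av i) }
dense-intersection {r = r} {suc M} A (suc t) B K N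
  | inj₂ _ | inj₁ (g , g-inj , C , C⊆ , N<) =
  inj₁ (suc ∘ g , g-inj ∘ Fin.suc-injective , C ,
    (λ v Cv → proj₁ (Equivalence.to T-∧ (proj₁ (C⊆ v Cv))) , proj₂ (C⊆ v Cv)) , N<)
-- Inside `A zero`, that set counts each point once and the others contribute the coefficient `t`;
-- outside, the others contribute `suc t`. So both halves of `B` get the same coefficient and
-- recombine.
dense-intersection {r = r} {suc M} A (suc t) B K N | inj₂ S₁≤ | inj₂ S₀≤ = inj₂ (begin
  K * (b₁ + sum (λ m → count r (λ v → B v ∧ A (suc m) v)))
    ≡⟨ cong (λ s → K * (b₁ + s)) (trans (sum-cong-≗ split) (∑-distrib-+ s₁ s₀)) ⟩
  K * (b₁ + (sum s₁ + sum s₀))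
    ≡⟨ distribute K b₁ (sum s₁) (sum s₀) ⟩
  K * b₁ + (K * sum s₁ + K * sum s₀)
    ≤⟨ ℕ.+-monoʳ-≤ (K * b₁) (ℕ.+-mono-≤ S₁≤ S₀≤) ⟩
  K * b₁ + (K * (t * b₁) + o₁ * N + (K * (suc t * b₀) + o₀ * N))
    ≡⟨ collect K b₁ b₀ t o₁ o₀ N ⟩
  K * (suc t * (b₁ + b₀)) + (o₁ + o₀) * N
    ≡⟨ cong (λ b → K * (suc t * b) + (o₁ + o₀) * N) (count-split r B (A zero)) ⟨
  K * (suc t * count r B) + (o₁ + o₀) * N ∎)
  where
  open ℕ.≤-Reasoning
  b₁ = count r (λ v → B v ∧ A zero v)
  b₀ = count r (λ v → B v ∧ not (A zero v))
  o₁ = slack M t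
  o₀ = slack M (suc t)
  s₁ s₀ : Fin M → ℕ
  s₁ m = count r (λ v → (B v ∧ A zero v) ∧ A (suc m) v)
  s₀ m = count r (λ v → (B v ∧ not (A zero v)) ∧ A (suc m) v)
  ∧-swap : ∀ a b c → (a ∧ b) ∧ c ≡ (a ∧ c) ∧ b
  ∧-swap a b c = trans (∧-assoc a b c) (trans (cong (a ∧_) (∧-comm b c)) (sym (∧-assoc a c b)))
  split : ∀ m → count r (λ v → B v ∧ A (suc m) v) ≡ s₁ m + s₀ m
  split m = trans (count-split r _ (A zero)) (cong₂ _+_
    (count-cong r λ v → ∧-swap (B v) (A (suc m) v) (A zero v))
    (count-cong r λ v → ∧-swap (B v) (A (suc m) v) (not (A zero v))))
  distribute : ∀ k b s s′ → k * (b + (s + s′)) ≡ k * b + (k * s + k * s′)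
  distribute = solve-∀
  collect : ∀ k b b′ t o o′ n →
    k * b + (k * (t * b) + o * n + (k * ((1 + t) * b′) + o′ * n)) ≡
    k * ((1 + t) * (b + b′)) + (o + o′) * n
  collect = solve-∀

-- A complete r-partite pattern with parts `X i` of size `t`. Disjointness of the parts is not
-- imposed; for tuples coming from an r-graph it follows from uniformity.
Box : ∀ {n} r → ℕ → (Vec (Fin n) r → Bool) → Set
Box {n} r t E = ∃ λ (X : Fin r → Fin t → Fin n) →
  (∀ i → Injective _≡_ _≡_ (X i)) ×
  (∀ (j : Fin r → Fin t) → T (E (tabulate λ i → X i (j i))))

-- Erdős' theorem, by induction on `r`. Many first coordinates have dense links, some `t` of these
-- links have a dense common part, and a box in that part is completed by the `t` coordinates. The
-- new density depends only on `q` and `t`, so the threshold is uniform in `n`.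
dense⇒box : ∀ r t q .{{_ : NonZero q}} → ∃ λ n₀ → ∀ n → n₀ ≤ n →
  ∀ (E : Vec (Fin n) r → Bool) → n ^ r ≤ q * count r E → Box r t E
dense⇒box zero t q = 0 , λ n _ E dense → (λ ()) , (λ ()) , λ _ → nonempty E dense
  where
  nonempty : ∀ {n} (E : Vec (Fin n) 0 → Bool) → 1 ≤ q * count 0 E → T (E [])
  nonempty E dense with E []
  ... | true  = tt
  ... | false = contradiction (subst (1 ≤_) (ℕ.*-zeroʳ q) dense) λ ()
dense⇒box (suc r) t q with dense⇒box r t (suc (slack (2 * q * suc t) t))
-- Once `n` exceeds `2 * q * M`, any `M` first coordinates carry less than half of the guaranteed
-- `n ^ suc r / q` tuples.
... | n₀ , box = suc (2 * q * M) ⊔ n₀ , λ n n₁≤n → step n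
    (ℕ.≤-trans (ℕ.m≤m⊔n _ n₀) n₁≤n) (ℕ.≤-trans (ℕ.m≤n⊔m (suc (2 * q * M)) n₀) n₁≤n)
  where
  open ℕ.≤-Reasoning
  -- `M` links of size at least `n ^ r / (2 * q)` have total size at least `suc t * n ^ r`, which is
  -- `n ^ r` more than tuples lying in at most `t` links each can account for.
  M = 2 * q * suc t
  o = slack M t
  step : ∀ n → 2 * q * M < n → n₀ ≤ n → ∀ (E : Vec (Fin n) (suc r) → Bool) →
         n ^ suc r ≤ q * count (suc r) E → Box (suc r) t E
  step n@(suc _) big n₀≤n E dense
    -- A link counts as large from half the average density on, that is from `1 / (2 * q)`; the
    -- factor `2 * q` clears the denominator.
    with many-large (λ x → 2 * q * count r (E ∘ (x ∷_))) (2 * q * n ^ r) (n ^ r)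
                    (λ x → ℕ.*-monoʳ-≤ (2 * q) (count-≤ r _)) M
  ... | inj₂ few = contradiction too-few (ℕ.<⇒≱ (ℕ.*-monoˡ-< (n ^ r) big))
    where
    instance _ = ℕ.m^n≢0 n r
    regroup : ∀ q M N → M * (2 * q * N) ≡ 2 * q * M * N
    regroup = solve-∀
    double : ∀ a → 2 * a ≡ a + a
    double = solve-∀
    too-few : n * n ^ r ≤ 2 * q * M * n ^ r
    too-few = ℕ.+-cancelʳ-≤ (n * n ^ r) _ _ (begin
      n * n ^ r + n * n ^ r                              ≡⟨ double (n * n ^ r) ⟨
      2 * (n * n ^ r)                                    ≤⟨ ℕ.*-monoʳ-≤ 2 dense ⟩
      2 * (q * count (suc r) E)                          ≡⟨ ℕ.*-assoc 2 q _ ⟨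
      2 * q * count (suc r) E                            ≡⟨ *-distribˡ-sum (2 * q) (λ x → count r (E ∘ (x ∷_))) ⟩
      sum (λ x → 2 * q * count r (E ∘ (x ∷_)))           ≤⟨ few ⟩
      M * (2 * q * n ^ r) + n * n ^ r                    ≡⟨ cong (_+ n * n ^ r) (regroup q M (n ^ r)) ⟩
      2 * q * M * n ^ r + n * n ^ r                      ∎)
  ... | inj₁ (g , g-inj , large)
    -- With the threshold density `1 / suc o`, the error term is `o / suc o` times `n ^ r`, just
    -- below the available excess `n ^ r`.
    with dense-intersection (λ m v → E (g m ∷ v)) t (const true) (suc o) (n ^ r)
  ...   | inj₁ (h , h-inj , C , C⊆ , C-dense)
    with box n n₀≤n C (ℕ.<⇒≤ C-dense)
  ...     | X , X-inj , X⊆C = X′ , X′-inj , λ j → proj₂ (C⊆ _ (X⊆C (j ∘ suc))) (j zero)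
    where
    X′ : Fin (suc r) → Fin t → Fin n
    X′ zero    = g ∘ h
    X′ (suc i) = X i
    X′-inj : ∀ i → Injective _≡_ _≡_ (X′ i)
    X′-inj zero    = h-inj ∘ g-inj
    X′-inj (suc i) = X-inj i
  step n@(suc _) big n₀≤n E dense | inj₁ (g , g-inj , large) | inj₂ thin =
    -- Cancelling the common terms leaves `n ^ r ≤ 0`.
    contradiction (ℕ.+-cancelʳ-≤ (suc o * (t * n ^ r) + o * n ^ r) _ _ (begin
      n ^ r + (suc o * (t * n ^ r) + o * n ^ r)   ≡⟨ regroup (n ^ r) o t ⟩
      suc o * (suc t * n ^ r)                     ≤⟨ ℕ.*-monoʳ-≤ (suc o) enough ⟩
      suc o * sum s                               ≤⟨ thin ⟩
      suc o * (t * count r (const true)) + o * n ^ r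
        ≡⟨ cong (λ c → suc o * (t * c) + o * n ^ r) (count-true n r) ⟩
      suc o * (t * n ^ r) + o * n ^ r             ∎))
      (ℕ.<⇒≱ (ℕ.m^n>0 n r))
    where
    instance _ = ℕ.m*n≢0 2 q
    s : Fin M → ℕ
    s m = count r (λ v → E (g m ∷ v))
    regroup : ∀ N o t → N + ((1 + o) * (t * N) + o * N) ≡ (1 + o) * ((1 + t) * N)
    regroup = solve-∀
    enough : suc t * n ^ r ≤ sum s
    enough = ℕ.*-cancelˡ-≤ (2 * q) (begin
      2 * q * (suc t * n ^ r)   ≡⟨ ℕ.*-assoc (2 * q) (suc t) _ ⟨
      M * n ^ r                 ≡⟨ sum-const M _ ⟨
      sum {M} (const (n ^ r))   ≤⟨ sum-mono large ⟩
      sum (λ m → 2 * q * s m)   ≡⟨ *-distribˡ-sum (2 * q) s ⟨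
      2 * q * sum s             ∎)

-- Enumerating finite sets, and sets as tuples of vertices.

sum-injective : ∀ {k n c} (h : Fin n → ℕ) (g : Fin k → Fin n) →
  Injective _≡_ _≡_ g → (∀ i → c ≤ h (g i)) → k * c ≤ sum h
sum-injective {zero}              h g g-inj c≤ = z≤n
sum-injective {suc k} {zero}      h g g-inj c≤ = contradiction (g zero) Fin.¬Fin0
sum-injective {suc k} {suc n} {c} h g g-inj c≤ = ℕ.≤-trans
  (ℕ.+-mono-≤ (c≤ zero) (sum-injective _ g′ g′-inj λ i →
    subst (λ x → c ≤ h x) (sym (Fin.punchIn-punchOut (g₀≢ i))) (c≤ (suc i))))
  (ℕ.≤-reflexive (sym (sum-remove {i = g zero} h)))
  where
  g₀≢ : ∀ i → g zero ≢ g (suc i)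
  g₀≢ i eq with g-inj eq
  ... | ()
  g′ : Fin k → Fin n
  g′ i = punchOut (g₀≢ i)
  g′-inj : Injective _≡_ _≡_ g′
  g′-inj {i} {j} eq = Fin.suc-injective (g-inj (Fin.punchOut-injective (g₀≢ i) (g₀≢ j) eq))

lookup-injective : ∀ {A : Set} {xs : List A} → Unique xs → Injective _≡_ _≡_ (List.lookup xs)
lookup-injective (x∉ ∷ uniq) {zero}  {zero}  eq = refl
lookup-injective (x∉ ∷ uniq) {zero}  {suc j} eq = contradiction eq (All.lookup x∉ (∈-lookup j))
lookup-injective (x∉ ∷ uniq) {suc i} {zero}  eq = contradiction (sym eq) (All.lookup x∉ (∈-lookup i))
lookup-injective (x∉ ∷ uniq) {suc i} {suc j} eq = cong suc (lookup-injective uniq eq)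

injective⇒≤length : ∀ {A : Set} {k} (xs : List A) (g : Fin k → A) →
  Injective _≡_ _≡_ g → (∀ i → g i ∈ˡ xs) → k ≤ length xs
injective⇒≤length xs g g-inj g∈ = Fin.injective⇒≤ {f = index ∘ g∈}
  λ {i} {j} eq → g-inj (index-injective (setoid _) (g∈ i) (g∈ j) eq)

∷-injective : ∀ {n s} {p q : Subset n} → s ∷ p ≡ s ∷ q → p ≡ q
∷-injective refl = refl

-- `degree` is the length of a filtered list: upper bounds on it need this list to have no
-- repetitions, lower bounds need it to be complete.
allSubsets-unique : ∀ n → Unique (allSubsets n)
allSubsets-unique zero    = [] ∷ []
allSubsets-unique (suc n) = Unique.++⁺
  (Unique.map⁺ ∷-injective (allSubsets-unique n))
  (Unique.map⁺ ∷-injective (allSubsets-unique n))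
  disjoint
  where
  disjoint : ∀ {e} → ¬ (e ∈ˡ List.map (inside ∷_) (allSubsets n) ×
                        e ∈ˡ List.map (outside ∷_) (allSubsets n))
  disjoint (e∈ , e∈′) with ∈-map⁻ (inside ∷_) e∈ | ∈-map⁻ (outside ∷_) e∈′
  ... | _ , _ , refl | _ , _ , ()

allSubsets-complete : ∀ {n} (e : Subset n) → e ∈ˡ allSubsets n
allSubsets-complete []            = here refl
allSubsets-complete (inside  ∷ e) = ∈-++⁺ˡ (∈-map⁺ (inside ∷_) (allSubsets-complete e))
allSubsets-complete (outside ∷ e) =
  ∈-++⁺ʳ (List.map (inside ∷_) (allSubsets _)) (∈-map⁺ (outside ∷_) (allSubsets-complete e))

⊆∧≥⇒≡ : ∀ {n} {p q : Subset n} → p ⊆ q → ∣ q ∣ ≤ ∣ p ∣ → p ≡ q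
⊆∧≥⇒≡ {p = p} {q} p⊆q q≤p = ⊆-antisym p⊆q q⊆p
  where
  q⊆p : q ⊆ p
  q⊆p {x} x∈q with x ∈? p
  ... | yes x∈p = x∈p
  ... | no x∉p  = contradiction q≤p (ℕ.<⇒≱ (p⊂q⇒∣p∣<∣q∣ (p⊆q , x , x∈q , x∉p)))

missing-element : ∀ {n} (p q : Subset n) → p ⊆ q → ∣ q ∣ ≡ suc ∣ p ∣ →
  ∃ λ x → x ∉ p × q ≡ ⁅ x ⁆ ∪ p
missing-element []            []            p⊆q ()
missing-element (inside  ∷ p) (outside ∷ q) p⊆q eq with p⊆q Vec.here
... | ()
missing-element (outside ∷ p) (inside  ∷ q) p⊆q eq = zero , (λ ()) ,
  cong (inside ∷_) (trans (sym (⊆∧≥⇒≡ (drop-∷-⊆ p⊆q) (ℕ.≤-reflexive (ℕ.suc-injective eq))))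
                          (sym (∪-identityˡ p)))
missing-element (inside  ∷ p) (inside  ∷ q) p⊆q eq
  with missing-element p q (drop-∷-⊆ p⊆q) (ℕ.suc-injective eq)
... | x , x∉p , q≡ = suc x , x∉p ∘ drop-there , cong (inside ∷_) q≡
missing-element (outside ∷ p) (outside ∷ q) p⊆q eq
  with missing-element p q (drop-∷-⊆ p⊆q) eq
... | x , x∉p , q≡ = suc x , x∉p ∘ drop-there , cong (outside ∷_) q≡

∣⁅x⁆∪p∣≤1+∣p∣ : ∀ {n} (x : Fin n) p → ∣ ⁅ x ⁆ ∪ p ∣ ≤ suc ∣ p ∣
∣⁅x⁆∪p∣≤1+∣p∣ zero    (inside  ∷ p) = s≤s (ℕ.≤-trans (ℕ.≤-reflexive (cong ∣_∣ (∪-identityˡ p))) (ℕ.n≤1+n _))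
∣⁅x⁆∪p∣≤1+∣p∣ zero    (outside ∷ p) = s≤s (ℕ.≤-reflexive (cong ∣_∣ (∪-identityˡ p)))
∣⁅x⁆∪p∣≤1+∣p∣ (suc x) (inside  ∷ p) = s≤s (∣⁅x⁆∪p∣≤1+∣p∣ x p)
∣⁅x⁆∪p∣≤1+∣p∣ (suc x) (outside ∷ p) = ∣⁅x⁆∪p∣≤1+∣p∣ x p

∣⁅x⁆∪p∣≡1+∣p∣ : ∀ {n} {x : Fin n} {p} → x ∉ p → ∣ ⁅ x ⁆ ∪ p ∣ ≡ suc ∣ p ∣
∣⁅x⁆∪p∣≡1+∣p∣ {x = x} {p} x∉p = ℕ.≤-antisym (∣⁅x⁆∪p∣≤1+∣p∣ x p)
  (p⊂q⇒∣p∣<∣q∣ (q⊆p∪q ⁅ x ⁆ p , x , p⊆p∪q p (x∈⁅x⁆ x) , x∉p))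

∈⁅x⁆∪p⁻ : ∀ {n} {x y : Fin n} {p} → y ∈ ⁅ x ⁆ ∪ p → y ≡ x ⊎ y ∈ p
∈⁅x⁆∪p⁻ {x = x} {p = p} y∈ with x∈p∪q⁻ ⁅ x ⁆ p y∈
... | inj₁ y∈⁅x⁆ = inj₁ (x∈⁅y⁆⇒x≡y x y∈⁅x⁆)
... | inj₂ y∈p   = inj₂ y∈p

x∈⁅x⁆∪p : ∀ {n} (x : Fin n) p → x ∈ ⁅ x ⁆ ∪ p
x∈⁅x⁆∪p x p = p⊆p∪q p (x∈⁅x⁆ x)

⁅⁆∪-injective : ∀ {n} {x y : Fin n} {p} → x ∉ p → ⁅ x ⁆ ∪ p ≡ ⁅ y ⁆ ∪ p → x ≡ y
⁅⁆∪-injective {x = x} {p = p} x∉p eq with ∈⁅x⁆∪p⁻ (subst (x ∈_) eq (x∈⁅x⁆∪p x p))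
... | inj₁ x≡y = x≡y
... | inj₂ x∈p = contradiction x∈p x∉p

-- Repeated entries collapse, so by uniformity `isEdge H ∘ toSet` accepts only tuples with distinct
-- entries; it describes the ordered edges of `H`.
toSet : ∀ {n r} → Vec (Fin n) r → Subset n
toSet []      = ⊥
toSet (x ∷ v) = ⁅ x ⁆ ∪ toSet v

toSet-map-suc : ∀ {n r} (v : Vec (Fin n) r) → toSet (Vec.map suc v) ≡ outside ∷ toSet v
toSet-map-suc []      = refl
toSet-map-suc (x ∷ v) = cong (⁅ suc x ⁆ ∪_) (toSet-map-suc v)

members : ∀ {n} (p : Subset n) → ∃ λ (v : Vec (Fin n) ∣ p ∣) → toSet v ≡ p
members []            = [] , refl
members (inside  ∷ p) with members p
... | v , eq = zero ∷ Vec.map suc v , trans (cong (⁅ zero ⁆ ∪_) (toSet-map-suc v))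
                                       (cong (inside ∷_) (trans (∪-identityˡ _) eq))
members (outside ∷ p) with members p
... | v , eq = Vec.map suc v , trans (toSet-map-suc v) (cong (outside ∷_) eq)

∣toSet∣≤ : ∀ {n r} (v : Vec (Fin n) r) → ∣ toSet v ∣ ≤ r
∣toSet∣≤ {n} []      = ℕ.≤-reflexive (∣⊥∣≡0 n)
∣toSet∣≤     (x ∷ v) = ℕ.≤-trans (∣⁅x⁆∪p∣≤1+∣p∣ x (toSet v)) (s≤s (∣toSet∣≤ v))

∈-toSet⁺ : ∀ {n r} (u : Fin r → Fin n) i → u i ∈ toSet (tabulate u)
∈-toSet⁺ u zero    = x∈⁅x⁆∪p (u zero) _
∈-toSet⁺ u (suc i) = q⊆p∪q ⁅ u zero ⁆ _ (∈-toSet⁺ (u ∘ suc) i)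

∈-toSet⁻ : ∀ {n r} (u : Fin r → Fin n) {x} → x ∈ toSet (tabulate u) → ∃ λ i → u i ≡ x
∈-toSet⁻ {r = zero}  u x∈ = contradiction x∈ ∉⊥
∈-toSet⁻ {r = suc r} u x∈ with ∈⁅x⁆∪p⁻ x∈
... | inj₁ x≡ = zero , sym x≡
... | inj₂ x∈′ with ∈-toSet⁻ (u ∘ suc) x∈′
...   | i , eq = suc i , eq

injective⇒∣toSet∣ : ∀ {n r} (u : Fin r → Fin n) → Injective _≡_ _≡_ u → ∣ toSet (tabulate u) ∣ ≡ r
injective⇒∣toSet∣ {n} {zero}  u u-inj = ∣⊥∣≡0 n
injective⇒∣toSet∣ {n} {suc r} u u-inj =
  trans (∣⁅x⁆∪p∣≡1+∣p∣ u₀∉) (cong suc (injective⇒∣toSet∣ (u ∘ suc) (Fin.suc-injective ∘ u-inj)))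
  where
  u₀∉ : u zero ∉ toSet (tabulate (u ∘ suc))
  u₀∉ u₀∈ with ∈-toSet⁻ (u ∘ suc) u₀∈
  ... | i , eq with u-inj eq
  ...   | ()

-- If the first entry recurred, the tail alone would give the whole set, which would then have fewer
-- than `r` elements.
∣toSet∣⇒injective : ∀ {n r} (u : Fin r → Fin n) → r ≤ ∣ toSet (tabulate u) ∣ → Injective _≡_ _≡_ u
∣toSet∣⇒injective {n} {suc r} u size = u-inj
  where
  p = toSet (tabulate (u ∘ suc))
  u₀≢ : ∀ i → u zero ≢ u (suc i)
  u₀≢ i eq = contradiction (ℕ.≤-trans size (ℕ.≤-trans (p⊆q⇒∣p∣≤∣q∣ absorb) (∣toSet∣≤ (tabulate (u ∘ suc))))) ℕ.1+n≰n
    where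
    absorb : ⁅ u zero ⁆ ∪ p ⊆ p
    absorb y∈ with ∈⁅x⁆∪p⁻ y∈
    ... | inj₁ refl = subst (_∈ p) (sym eq) (∈-toSet⁺ (u ∘ suc) i)
    ... | inj₂ y∈p  = y∈p
  tail-inj : Injective _≡_ _≡_ (u ∘ suc)
  tail-inj = ∣toSet∣⇒injective (u ∘ suc) (ℕ.≤-pred (ℕ.≤-trans size (∣⁅x⁆∪p∣≤1+∣p∣ (u zero) p)))
  u-inj : Injective _≡_ _≡_ u
  u-inj {zero}  {zero}  eq = refl
  u-inj {zero}  {suc j} eq = contradiction eq (u₀≢ j)
  u-inj {suc i} {zero}  eq = contradiction (sym eq) (u₀≢ i)
  u-inj {suc i} {suc j} eq = cong suc (tail-inj eq)

∈-image⁺ : ∀ {m n} (f : Fin m → Fin n) {e i} → i ∈ e → f i ∈ image f e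
∈-image⁺ f {e} {i} i∈e = lookup⇒[]= (f i) _ (trans (lookup∘tabulate _ (f i))
  (dec-true (Fin.any? λ i′ → (i′ ∈? e) ×-dec (f i′ Fin.≟ f i)) (i , i∈e , refl)))

∈-image⁻ : ∀ {m n} (f : Fin m → Fin n) {e j} → j ∈ image f e → ∃ λ i → i ∈ e × f i ≡ j
∈-image⁻ f {e} {j} j∈
  with Fin.any? (λ i → (i ∈? e) ×-dec (f i Fin.≟ j)) | trans (sym (lookup∘tabulate _ j)) ([]=⇒lookup j∈)
... | yes found | _  = found
... | no  _     | ()

-- Counting ordered edges from the positive codegree.

degree-≤-sum : ∀ {r n} (H : RGraph r n) (S : Subset n) → suc ∣ S ∣ ≡ r →
  ∀ c (h : Fin n → ℕ) → (∀ x → x ∉ S → Edge H (⁅ x ⁆ ∪ S) → c ≤ h x) → degree H S * c ≤ sum h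
degree-≤-sum {n = n} H S ∣S∣ c h c≤ = sum-injective h (proj₁ ∘ ext) ext-inj
  λ i → c≤ _ (proj₁ (proj₂ (ext i))) (subst (Edge H) (proj₂ (proj₂ (ext i))) (proj₁ (edge i)))
  where
  P? : ∀ e → Dec (Edge H e × S ⊆ e)
  P? e = Edge? H e ×-dec (S ⊆? e)
  edges = filter P? (allSubsets n)
  edge : ∀ i → Edge H (List.lookup edges i) × S ⊆ List.lookup edges i
  edge i = proj₂ (∈-filter⁻ P? {xs = allSubsets n} (∈-lookup {xs = edges} i))
  ext : ∀ i → ∃ λ x → x ∉ S × List.lookup edges i ≡ ⁅ x ⁆ ∪ S
  ext i = missing-element S _ (proj₂ (edge i)) (trans (uniform H _ (proj₁ (edge i))) (sym ∣S∣))
  -- Distinct edges through `S` add distinct vertices, so the degree of `S` counts vertices `x`,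
  -- each worth at least `c`.
  ext-inj : Injective _≡_ _≡_ (proj₁ ∘ ext)
  ext-inj {i} {j} eq = lookup-injective (Unique.filter⁺ P? (allSubsets-unique n))
    (trans (proj₂ (proj₂ (ext i))) (trans (cong (λ x → ⁅ x ⁆ ∪ S) eq) (sym (proj₂ (proj₂ (ext j))))))

-- Replaces the vertices of an edge one at a time: `B` holds those already replaced and `w` the old
-- ones still present. Dropping the head of `w` leaves a set of `r - 1` vertices inside an edge, so
-- there are at least `k` choices for its successor, which joins `B`.
count-extensions : ∀ {r n k} (H : RGraph r n) → MinPositiveCodegree≥ H k →
  ∀ s (B : Subset n) (w : Vec (Fin n) s) → ∣ B ∣ + s ≤ r → Edge H (B ∪ toSet w) →
  k ^ s ≤ count s (λ v → isEdge H (B ∪ toSet v))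
count-extensions H k≤ zero B [] size edge with isEdge H (B ∪ ⊥)
... | true  = ℕ.≤-refl
count-extensions {r} {n} {k} H k≤ (suc s) B (a ∷ w) size edge =
  ℕ.≤-trans (ℕ.*-monoˡ-≤ (k ^ s) (k≤ S (cong (_∸ 1) ∣S∣) (⁅ a ⁆ ∪ S , edge′ , q⊆p∪q ⁅ a ⁆ S)))
            (degree-≤-sum H S ∣S∣ (k ^ s) _ extend)
  where
  S = B ∪ toSet w
  swap : ∀ x p → ⁅ x ⁆ ∪ (B ∪ p) ≡ (B ∪ ⁅ x ⁆) ∪ p
  swap x p = trans (sym (∪-assoc ⁅ x ⁆ B p)) (cong (_∪ p) (∪-comm ⁅ x ⁆ B))
  edge′ : Edge H (⁅ a ⁆ ∪ S)
  edge′ = subst (Edge H) (sym (trans (swap a (toSet w)) (∪-assoc B ⁅ a ⁆ (toSet w)))) edge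
  ∣∪∣≤ : ∀ {s} p (v : Vec (Fin n) s) → ∣ p ∪ toSet v ∣ ≤ ∣ p ∣ + s
  ∣∪∣≤ p []      = ℕ.≤-reflexive (trans (cong ∣_∣ (∪-identityʳ p)) (sym (ℕ.+-identityʳ ∣ p ∣)))
  ∣∪∣≤ {suc s} p (x ∷ v) = begin
    ∣ p ∪ (⁅ x ⁆ ∪ toSet v) ∣  ≡⟨ cong ∣_∣ (trans (sym (∪-assoc p ⁅ x ⁆ (toSet v)))
                                   (trans (cong (_∪ toSet v) (∪-comm p ⁅ x ⁆)) (∪-assoc ⁅ x ⁆ p (toSet v)))) ⟩
    ∣ ⁅ x ⁆ ∪ (p ∪ toSet v) ∣  ≤⟨ ∣⁅x⁆∪p∣≤1+∣p∣ x _ ⟩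
    suc ∣ p ∪ toSet v ∣        ≤⟨ s≤s (∣∪∣≤ p v) ⟩
    suc (∣ p ∣ + s)            ≡⟨ ℕ.+-suc ∣ p ∣ s ⟨
    ∣ p ∣ + suc s              ∎
    where open ℕ.≤-Reasoning
  -- The hypothesis on `B` gives only an upper bound; the lower one comes from the `r` vertices of
  -- the edge.
  ∣S∣ : suc ∣ S ∣ ≡ r
  ∣S∣ = ℕ.≤-antisym
    (ℕ.≤-trans (s≤s (∣∪∣≤ B w)) (ℕ.≤-trans (ℕ.≤-reflexive (sym (ℕ.+-suc ∣ B ∣ s))) size))
    (ℕ.≤-trans (ℕ.≤-reflexive (sym (uniform H _ edge′))) (∣⁅x⁆∪p∣≤1+∣p∣ a S))
  extend : ∀ x → x ∉ S → Edge H (⁅ x ⁆ ∪ S) → k ^ s ≤ count s (λ v → isEdge H (B ∪ (⁅ x ⁆ ∪ toSet v)))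
  extend x _ edgeₓ = ℕ.≤-trans
    (count-extensions H k≤ s (B ∪ ⁅ x ⁆) w
      (ℕ.≤-trans (ℕ.+-monoˡ-≤ s (ℕ.≤-trans (ℕ.≤-reflexive (cong ∣_∣ (∪-comm B ⁅ x ⁆))) (∣⁅x⁆∪p∣≤1+∣p∣ x B)))
                 (ℕ.≤-trans (ℕ.≤-reflexive (sym (ℕ.+-suc ∣ B ∣ s))) size))
      (subst (Edge H) (swap x (toSet w)) edgeₓ))
    (ℕ.≤-reflexive (count-cong s λ v → cong (isEdge H) (∪-assoc B ⁅ x ⁆ (toSet v))))

count-edges : ∀ {r n k} (H : RGraph r n) → ∃ (Edge H) → MinPositiveCodegree≥ H k →
  k ^ r ≤ count r (isEdge H ∘ toSet)
count-edges {r} {n} {k} H (e , He) k≤ with uniform H e He | members e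
... | refl | w , eq = ℕ.≤-trans
  (count-extensions H k≤ ∣ e ∣ ⊥ w (ℕ.≤-reflexive (cong (_+ ∣ e ∣) (∣⊥∣≡0 n)))
    (subst (Edge H) (sym (trans (∪-identityˡ _) eq)) He))
  (ℕ.≤-reflexive (count-cong ∣ e ∣ λ v → cong (isEdge H) (∪-identityˡ (toSet v))))

-- Partite r-graphs and the complete r-partite r-graph.

Rainbow : ∀ {n r} → (Fin n → Fin r) → Subset n → Set
Rainbow c e = (∀ i → ∃ λ x → x ∈ e × c x ≡ i) ×
              (∀ x y → x ∈ e → y ∈ e → c x ≡ c y → x ≡ y)

rainbow? : ∀ {n r} (c : Fin n → Fin r) e → Dec (Rainbow c e)
rainbow? c e =
  Fin.all? (λ i → Fin.any? λ x → (x ∈? e) ×-dec (c x Fin.≟ i)) ×-dec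
  Fin.all? (λ x → Fin.all? λ y →
    (x ∈? e) →-dec ((y ∈? e) →-dec ((c x Fin.≟ c y) →-dec (x Fin.≟ y))))

IsPartite : ∀ {r n} → RGraph r n → (Fin n → Fin r) → Set
IsPartite F c = ∀ e → Edge F e → Rainbow c e

-- Each part has a slot for every vertex of `F`, so `w` can take slot `w` of the part given by its
-- colour. A rainbow edge has one vertex in each part, hence its image is one of the edges of the
-- box.
box⇒contains : ∀ {r n v} (H : RGraph r n) (F : RGraph r v) {c} → IsPartite F c →
  Box r v (isEdge H ∘ toSet) → H Contains F
box⇒contains {r} {n} {v} H F {c} partite (X , X-inj , box) = f , f-inj , hom
  where
  f : Fin v → Fin n
  f w = X (c w) w
  -- Vertices w, w′ of different colours go to different vertices because f w and
  -- f w′ are two of the r entries of an edge of the box.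
  f-inj : Injective _≡_ _≡_ f
  f-inj {w} {w′} eq with c w Fin.≟ c w′
  ... | yes same = X-inj (c w) (trans eq (cong (λ i → X i w′) (sym same)))
  ... | no differ = contradiction (∣toSet∣⇒injective (λ i → X i (j i))
      (ℕ.≤-reflexive (sym (uniform H _ (box j)))) (trans at-w (trans eq (sym at-w′)))) differ
    where
    -- Only the parts `c w` and `c w′` matter; every other part takes the default `w′`.
    j : Fin r → Fin v
    j i with i Fin.≟ c w
    ... | yes _ = w
    ... | no  _ = w′
    at-w : X (c w) (j (c w)) ≡ f w
    at-w with c w Fin.≟ c w
    ... | yes _ = refl
    ... | no w≢w = contradiction refl w≢w
    at-w′ : X (c w′) (j (c w′)) ≡ f w′
    at-w′ with c w′ Fin.≟ c w
    ... | yes eq = contradiction (sym eq) differ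
    ... | no _  = refl
  hom : ∀ e → Edge F e → Edge H (image f e)
  hom e Fe = subst (Edge H) (⊆-antisym box⊆image image⊆box) (box j)
    where
    onto = proj₁ (partite e Fe)
    j : Fin r → Fin v
    j i = proj₁ (onto i)
    u : Fin r → Fin n
    u i = X i (j i)
    u≡f : ∀ i → u i ≡ f (j i)
    u≡f i = cong (λ i′ → X i′ (j i)) (sym (proj₂ (proj₂ (onto i))))
    box⊆image : toSet (tabulate u) ⊆ image f e
    box⊆image x∈ with ∈-toSet⁻ u x∈
    ... | i , refl = subst (_∈ image f e) (sym (u≡f i)) (∈-image⁺ f (proj₁ (proj₂ (onto i))))
    image⊆box : image f e ⊆ toSet (tabulate u)
    image⊆box x∈ with ∈-image⁻ f x∈
    ... | w , w∈e , refl = subst (_∈ toSet (tabulate u))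
      (trans (u≡f (c w)) (cong f (proj₂ (partite e Fe) _ w (proj₁ (proj₂ (onto (c w)))) w∈e
                                   (proj₂ (proj₂ (onto (c w)))))))
      (∈-toSet⁺ u (c w))

completePartite : ∀ {r n} → (Fin n → Fin r) → RGraph r n
completePartite {r} c = record
  { isEdge  = λ e → isYes (rainbow? c e ×-dec (∣ e ∣ ≟ r))
  ; uniform = λ e Ke → proj₂ (toWitness Ke)
  }

-- A copy of `F` would pull the colouring back along the embedding and make `F` partite.
completePartite-free : ∀ {r n v} (c : Fin n → Fin r) (F : RGraph r v) →
  (∀ c′ → ¬ IsPartite F c′) → completePartite c IsFree F
completePartite-free c F ¬partite (f , f-inj , hom) = ¬partite (c ∘ f) λ e Fe →
  let onto , inj = proj₁ (toWitness (hom e Fe)) in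
  (λ i → let x , x∈ , cx≡i = onto i ; w , w∈e , fw≡x = ∈-image⁻ f x∈
         in w , w∈e , trans (cong c fw≡x) cx≡i) ,
  (λ w w′ w∈ w′∈ eq → f-inj (inj (f w) (f w′) (∈-image⁺ f w∈) (∈-image⁺ f w′∈) eq))

module _ {r n m} (c : Fin n → Fin r) (φ : Fin r → Fin m → Fin n)
         (c∘φ : ∀ i a → c (φ i a) ≡ i) (φ-inj : ∀ i → Injective _≡_ _≡_ (φ i)) where

  completePartite-edge : Fin m → ∃ (Edge (completePartite c))
  completePartite-edge a = toSet (tabulate u) , fromWitness ((onto , inj) , injective⇒∣toSet∣ u u-inj)
    where
    u : Fin r → Fin n
    u i = φ i a
    u-inj : Injective _≡_ _≡_ u
    u-inj {i} {j} eq = trans (sym (c∘φ i a)) (trans (cong c eq) (c∘φ j a))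
    onto : ∀ i → ∃ λ x → x ∈ toSet (tabulate u) × c x ≡ i
    onto i = u i , ∈-toSet⁺ u i , c∘φ i a
    inj : ∀ x y → x ∈ toSet (tabulate u) → y ∈ toSet (tabulate u) → c x ≡ c y → x ≡ y
    inj x y x∈ y∈ eq with ∈-toSet⁻ u x∈ | ∈-toSet⁻ u y∈
    ... | i , refl | j , refl = cong u (trans (sym (c∘φ i a)) (trans eq (c∘φ j a)))

  -- An edge through `S` adds one vertex `w`, whose colour is the only one absent from `S`. Each of
  -- the `m` vertices that `φ` lists in that colour can stand in for `w`.
  completePartite-codegree : 1 ≤ r → MinPositiveCodegree≥ (completePartite c) m
  completePartite-codegree 1≤r S ∣S∣ (e , Ke , S⊆e)
    with toWitness Ke
  ... | (onto , inj) , ∣e∣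
    with missing-element S e S⊆e (trans ∣e∣ (trans (sym (ℕ.m+[n∸m]≡n 1≤r)) (cong suc (sym ∣S∣))))
  ...   | w , w∉S , refl = injective⇒≤length _ new new-inj λ a →
            ∈-filter⁺ (λ e′ → Edge? (completePartite c) e′ ×-dec (S ⊆? e′))
              (allSubsets-complete (new a)) (edge a , q⊆p∪q ⁅ x a ⁆ S)
    where
    x : Fin m → Fin n
    x a = φ (c w) a
    new : Fin m → Subset n
    new a = ⁅ x a ⁆ ∪ S
    w∈e : w ∈ ⁅ w ⁆ ∪ S
    w∈e = x∈⁅x⁆∪p w S
    colour-fresh : ∀ {y} → y ∈ S → c y ≢ c w
    colour-fresh y∈S eq = w∉S (subst (_∈ S) (inj _ w (S⊆e y∈S) w∈e eq) y∈S)
    x∉S : ∀ a → x a ∉ S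
    x∉S a x∈S = colour-fresh x∈S (c∘φ (c w) a)
    new-inj : Injective _≡_ _≡_ new
    new-inj {a} eq = φ-inj (c w) (⁅⁆∪-injective (x∉S a) eq)
    onto′ : ∀ a i → ∃ λ y → y ∈ new a × c y ≡ i
    onto′ a i with onto i
    ... | y , y∈e , cy≡i with ∈⁅x⁆∪p⁻ y∈e
    ...   | inj₁ refl = x a , x∈⁅x⁆∪p (x a) S , trans (c∘φ (c w) a) cy≡i
    ...   | inj₂ y∈S  = y , q⊆p∪q ⁅ x a ⁆ S y∈S , cy≡i
    inj′ : ∀ a y z → y ∈ new a → z ∈ new a → c y ≡ c z → y ≡ z
    inj′ a y z y∈ z∈ eq with ∈⁅x⁆∪p⁻ y∈ | ∈⁅x⁆∪p⁻ z∈
    ... | inj₁ y≡x  | inj₁ z≡x  = trans y≡x (sym z≡x)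
    ... | inj₁ refl | inj₂ z∈S  = contradiction (trans (sym eq) (c∘φ (c w) a)) (colour-fresh z∈S)
    ... | inj₂ y∈S  | inj₁ refl = contradiction (trans eq (c∘φ (c w) a)) (colour-fresh y∈S)
    ... | inj₂ y∈S  | inj₂ z∈S  = inj y z (S⊆e y∈S) (S⊆e z∈S) eq
    edge : ∀ a → Edge (completePartite c) (new a)
    edge a = fromWitness ((onto′ a , inj′ a) ,
      trans (trans (∣⁅x⁆∪p∣≡1+∣p∣ (x∉S a)) (sym (∣⁅x⁆∪p∣≡1+∣p∣ w∉S))) ∣e∣)

-- The extremal function for partite and non-partite `F`.

δ⁺-greatest : ∀ {r n k} (H : RGraph r n) → ∃ (Edge H) → MinPositiveCodegree≥ H k → k ≤ δ⁺ H
δ⁺-greatest H ∃e k≤ with ∃-minPositiveCodegree H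
... | _ , inj₁ (_ , _ , max) = max _ k≤
... | _ , inj₂ (¬∃e , _)     = contradiction ∃e ¬∃e

δ⁺-positive : ∀ {r n} (H : RGraph r n) → 1 ≤ δ⁺ H → ∃ (Edge H) × MinPositiveCodegree≥ H (δ⁺ H)
δ⁺-positive H 1≤δ with ∃-minPositiveCodegree H
... | _ , inj₁ (∃e , k≤ , _) = ∃e , k≤
... | _ , inj₂ (_ , refl)    = contradiction 1≤δ λ ()

co⁺ex-greatest : ∀ {r n v} (F : RGraph r v) (H : RGraph r n) → H IsFree F → δ⁺ H ≤ co⁺ex n F
co⁺ex-greatest {n = n} F H free with ∃-co⁺ex n F
... | _ , inj₁ (_ , max)   = max _ (H , free , refl)
... | _ , inj₂ (none , _)  = contradiction free (none H)

-- A positive value comes from neither convention for 0, so it is attained, and by a graph that has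
-- an edge.
co⁺ex-positive : ∀ {r v} n (F : RGraph r v) → 1 ≤ co⁺ex n F →
  ∃ λ (H : RGraph r n) → H IsFree F × ∃ (Edge H) × MinPositiveCodegree≥ H (co⁺ex n F)
co⁺ex-positive n F 1≤ with ∃-co⁺ex n F
... | _ , inj₁ ((H , free , refl) , _) = H , free , δ⁺-positive H 1≤
... | _ , inj₂ (_ , refl)              = contradiction 1≤ λ ()

co⁺ex-nonpartite : ∀ {r v} m (F : RGraph r v) → 1 ≤ r → (∀ c → ¬ IsPartite F c) → m ≤ co⁺ex (r * m) F
-- Empty parts would give no edge, hence the separate case.
co⁺ex-nonpartite zero F 1≤r ¬partite = z≤n
co⁺ex-nonpartite {r} m@(suc _) F 1≤r ¬partite = ℕ.≤-trans
  (δ⁺-greatest K (completePartite-edge c combine c∘φ φ-inj zero)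
                 (completePartite-codegree c combine c∘φ φ-inj 1≤r))
  (co⁺ex-greatest F K (completePartite-free c F ¬partite))
  where
  c : Fin (r * m) → Fin r
  c x = proj₁ (remQuot m x)
  K = completePartite c
  c∘φ : ∀ i a → c (combine i a) ≡ i
  c∘φ i a = cong proj₁ (Fin.remQuot-combine i a)
  φ-inj : ∀ i → Injective _≡_ _≡_ (combine {r} {m} i)
  φ-inj i eq = Fin.combine-injectiveʳ i _ i _ eq

^-distribʳ-* : ∀ a b n → (a * b) ^ n ≡ a ^ n * b ^ n
^-distribʳ-* a b zero    = refl
^-distribʳ-* a b (suc n) = trans (cong (a * b *_) (^-distribʳ-* a b n)) (interchange a b (a ^ n) (b ^ n))
  where
  interchange : ∀ a b c d → a * b * (c * d) ≡ a * c * (b * d)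
  interchange = solve-∀

-- The density 0 in terms of natural numbers: the ratio falls below every `1 / suc q`.
co⁺ex-partite : ∀ {r v} (F : RGraph r v) {c} → IsPartite F c → ∀ q →
  ∃ λ n₀ → ∀ n → n₀ ≤ n → 1 ≤ n → suc q * co⁺ex n F < n
co⁺ex-partite {r} {v} F partite q with dense⇒box r v (suc q ^ r) {{ℕ.m^n≢0 (suc q) r}}
... | n₀ , box = n₀ , λ n n₀≤n 1≤n → ℕ.≰⇒> λ n≤ →
  let H , free , ∃e , k≤ = co⁺ex-positive n F (positive n 1≤n (co⁺ex n F) n≤) in
  free (box⇒contains H F partite (box n n₀≤n (isEdge H ∘ toSet) (begin
    n ^ r                                      ≤⟨ ℕ.^-monoˡ-≤ r n≤ ⟩
    (suc q * co⁺ex n F) ^ r                    ≡⟨ ^-distribʳ-* (suc q) _ r ⟩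
    suc q ^ r * co⁺ex n F ^ r                  ≤⟨ ℕ.*-monoʳ-≤ (suc q ^ r) (count-edges H ∃e k≤) ⟩
    suc q ^ r * count r (isEdge H ∘ toSet)     ∎)))
  where
  open ℕ.≤-Reasoning
  positive : ∀ n → 1 ≤ n → ∀ k → n ≤ suc q * k → 1 ≤ k
  positive n 1≤n zero    n≤ = contradiction (ℕ.≤-trans 1≤n (subst (n ≤_) (ℕ.*-zeroʳ (suc q)) n≤)) λ ()
  positive n 1≤n (suc k) n≤ = s≤s z≤n

-- Fractions, and limits turned into inequalities of natural numbers.

fromℚᵘ-mono-≤ : ∀ {p q : ℚᵘ.ℚᵘ} → p ℚᵘ.≤ q → ℚ.fromℚᵘ p ℚ.≤ ℚ.fromℚᵘ q
fromℚᵘ-mono-≤ {p} {q} p≤q = ℚ.toℚᵘ-cancel-≤ (ℚᵘ.≤-respʳ-≃ (ℚᵘ.≃-sym (ℚ.toℚᵘ-fromℚᵘ q))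
  (ℚᵘ.≤-respˡ-≃ (ℚᵘ.≃-sym (ℚ.toℚᵘ-fromℚᵘ p)) p≤q))

-- `_÷_` reduces to lowest terms, so the cross-multiplication takes place in the unnormalised
-- rationals.
÷-mono-≤ : ∀ {a b m n} → a * suc n ≤ b * suc m → a ÷ suc m ℚ.≤ b ÷ suc n
÷-mono-≤ {a} {b} {m} {n} le = fromℚᵘ-mono-≤ {mkℚᵘ (ℤ.+ a) m} {mkℚᵘ (ℤ.+ b) n}
  (ℚᵘ.*≤* (subst₂ ℤ._≤_ (ℤ.pos-* a (suc n)) (ℤ.pos-* b (suc m)) (ℤ.+≤+ le)))

unit-fraction-below : ∀ x → 0ℚ ℚ.< x → ∃ λ q → 1 ÷ suc q ℚ.≤ x
unit-fraction-below x@(mkℚ (ℤ.+ zero) _ _)  (ℚ.*<* (ℤ.+<+ ()))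
unit-fraction-below x@(mkℚ (ℤ.-[1+ _ ]) _ _) (ℚ.*<* ())
-- The denominator of `x` itself serves, as the numerator is at least 1.
unit-fraction-below x@(mkℚ (ℤ.+ suc p) d c) _ = d , subst (1 ÷ suc d ℚ.≤_) (ℚ.fromℚᵘ-toℚᵘ x)
  (÷-mono-≤ {1} {suc p} {d} {d} (ℕ.*-monoˡ-≤ (suc d) (s≤s (z≤n {p}))))

+-cancel-pos-< : ∀ {a b c d} → 0ℚ ℚ.< d → a ℚ.+ d ℚ.≤ b → b ℚ.≤ c → a ℚ.< c
+-cancel-pos-< {a} {b} {c} {d} 0<d le b≤c = ℚ.<-≤-trans
  (subst (ℚ._< a ℚ.+ d) (ℚ.+-identityʳ a) (ℚ.+-monoʳ-< a 0<d)) (ℚ.≤-trans le b≤c)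

module _ {a : ℕ → ℚ} {x : ℝ} (a→x : a ConvergesTo x) where

  -- The gap `ε` between `x` and `q` serves as the tolerance of convergence, so it cancels; the
  -- margin `δ` of the convergence keeps the inequality strict. Both bounds are read off at one
  -- common index of the sequence of `x`.
  eventually-below : ∀ q → x <ℝ fromℚ q → ∃ λ N → ∀ n → N ≤ n → a n ℚ.< q
  eventually-below q (ε , 0<ε , N₁ , below) with a→x ε 0<ε
  ... | N₂ , close = N₂ , λ n N₂≤n → bound n (proj₁ (close n N₂≤n))
    where
    bound : ∀ n → fromℚ (a n ℚ.- ε) <ℝ x → a n ℚ.< q
    bound n (δ , 0<δ , N₃ , above) = +-cancel-pos-< 0<δ (begin
      a n ℚ.+ δ                           ≡⟨ cong (ℚ._+ δ) (ℚ.+-identityʳ (a n)) ⟨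
      a n ℚ.+ 0ℚ ℚ.+ δ                    ≡⟨ cong (λ z → a n ℚ.+ z ℚ.+ δ) (ℚ.+-inverseˡ ε) ⟨
      a n ℚ.+ (ℚ.- ε ℚ.+ ε) ℚ.+ δ         ≡⟨ cong (ℚ._+ δ) (ℚ.+-assoc (a n) (ℚ.- ε) ε) ⟨
      a n ℚ.- ε ℚ.+ ε ℚ.+ δ               ≡⟨ ℚ.+-assoc (a n ℚ.- ε) ε δ ⟩
      a n ℚ.- ε ℚ.+ (ε ℚ.+ δ)             ≡⟨ cong (a n ℚ.- ε ℚ.+_) (ℚ.+-comm ε δ) ⟩
      a n ℚ.- ε ℚ.+ (δ ℚ.+ ε)             ≡⟨ ℚ.+-assoc (a n ℚ.- ε) δ ε ⟨
      a n ℚ.- ε ℚ.+ δ ℚ.+ ε               ≤⟨ ℚ.+-monoˡ-≤ ε (above m (ℕ.m≤n⊔m N₁ N₃)) ⟩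
      ℝ.seq x m ℚ.+ ε                     ∎) (below m (ℕ.m≤m⊔n N₁ N₃))
      where
      open ℚ.≤-Reasoning
      m = N₁ ⊔ N₃

  eventually-above : ∀ q → fromℚ q <ℝ x → ∃ λ N → ∀ n → N ≤ n → q ℚ.< a n
  eventually-above q (ε , 0<ε , N₁ , above) with a→x ε 0<ε
  ... | N₂ , close = N₂ , λ n N₂≤n → bound n (proj₂ (close n N₂≤n))
    where
    bound : ∀ n → x <ℝ fromℚ (a n ℚ.+ ε) → q ℚ.< a n
    bound n (δ , 0<δ , N₃ , below) = +-cancel-pos-< 0<δ (ℚ.≤-refl {q ℚ.+ δ}) (ε-cancel (begin
      q ℚ.+ δ ℚ.+ ε                       ≡⟨ ℚ.+-assoc q δ ε ⟩
      q ℚ.+ (δ ℚ.+ ε)                     ≡⟨ cong (q ℚ.+_) (ℚ.+-comm δ ε) ⟩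
      q ℚ.+ (ε ℚ.+ δ)                     ≡⟨ ℚ.+-assoc q ε δ ⟨
      q ℚ.+ ε ℚ.+ δ                       ≤⟨ ℚ.+-monoˡ-≤ δ (above m (ℕ.m≤m⊔n N₁ N₃)) ⟩
      ℝ.seq x m ℚ.+ δ                     ≤⟨ below m (ℕ.m≤n⊔m N₁ N₃) ⟩
      a n ℚ.+ ε                           ∎))
      where
      open ℚ.≤-Reasoning
      m = N₁ ⊔ N₃
      ε-cancel : ∀ {y z} → y ℚ.+ ε ℚ.≤ z ℚ.+ ε → y ℚ.≤ z
      ε-cancel {y} {z} le = subst₂ ℚ._≤_ (cancel y) (cancel z) (ℚ.+-monoˡ-≤ (ℚ.- ε) le)
        where
        cancel : ∀ y → y ℚ.+ ε ℚ.- ε ≡ y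
        cancel y = trans (ℚ.+-assoc y ε (ℚ.- ε)) (trans (cong (y ℚ.+_) (ℚ.+-inverseʳ ε)) (ℚ.+-identityʳ y))

0<x⇒positive-lower-bound : ∀ {x} → 0ℝ <ℝ x → ∃ λ η → 0ℚ ℚ.< η × fromℚ η <ℝ x
0<x⇒positive-lower-bound {x} (ε , 0<ε , N , above) with ℚ.<-dense 0<ε
-- Any `η` strictly between 0 and `ε` leaves the gap `ε - η` between itself and `x`.
... | η , 0<η , η<ε = η , 0<η , ε ℚ.- η ,
  subst (ℚ._< ε ℚ.- η) (ℚ.+-inverseʳ η) (ℚ.+-monoˡ-< (ℚ.- η) η<ε) , N , λ n N≤n → begin
    η ℚ.+ (ε ℚ.- η)           ≡⟨ ℚ.+-comm η (ε ℚ.- η) ⟩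
    ε ℚ.- η ℚ.+ η             ≡⟨ ℚ.+-assoc ε (ℚ.- η) η ⟩
    ε ℚ.+ (ℚ.- η ℚ.+ η)       ≡⟨ cong (ε ℚ.+_) (ℚ.+-inverseˡ η) ⟩
    ε ℚ.+ 0ℚ                  ≡⟨ ℚ.+-comm ε 0ℚ ⟩
    0ℚ ℚ.+ ε                  ≤⟨ above n N≤n ⟩
    ℝ.seq x n                 ∎
  where open ℚ.≤-Reasoning

÷-cancel-< : ∀ {a b m n} → 1 ≤ m → 1 ≤ n → a ÷ m ℚ.< b ÷ n → a * n < b * m
÷-cancel-< {a} {b} {suc m} {suc n} _ _ lt = ℕ.≰⇒> λ le →
  ℚ.<-irrefl refl (ℚ.<-≤-trans lt (÷-mono-≤ {b} {a} {n} {m} le))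

module _ {k : ℕ → ℕ} {x : ℝ} (k/n→x : (λ n → k n ÷ n) ConvergesTo x) where

  positive-limit : 0ℝ <ℝ x → ∃ λ q → ∃ λ N → ∀ n → N ≤ n → 1 ≤ n → n < suc q * k n
  positive-limit 0<x with 0<x⇒positive-lower-bound {x} 0<x
  ... | η , 0<η , η<x with unit-fraction-below η 0<η | eventually-above {λ n → k n ÷ n} {x} k/n→x η η<x
  ...   | q , 1/q≤η | N , above = q , N , λ n N≤n 1≤n →
    subst₂ _<_ (ℕ.*-identityˡ n) (ℕ.*-comm (k n) (suc q))
      (÷-cancel-< {1} {k n} {suc q} {n} (s≤s z≤n) 1≤n (ℚ.≤-<-trans 1/q≤η (above n N≤n)))

  limit-below-unit-fraction : ∀ {r} → 1 ≤ r → x <ℝ fromℚ (1 ÷ r) →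
    ∃ λ N → ∀ n → N ≤ n → 1 ≤ n → k n * r < n
  limit-below-unit-fraction {r} 1≤r x<1/r with eventually-below {λ n → k n ÷ n} {x} k/n→x (1 ÷ r) x<1/r
  ... | N , below = N , λ n N≤n 1≤n →
    subst (k n * r <_) (ℕ.*-identityˡ n) (÷-cancel-< {k n} {1} {n} {r} 1≤n 1≤r (below n N≤n))

-- The dichotomy for the limit.

positive-density⇒nonpartite : ∀ {r v} (F : RGraph r v) {γ} →
  IsPositiveCodegreeDensity F γ → 0ℝ <ℝ γ → ∀ c → ¬ IsPartite F c
positive-density⇒nonpartite F {γ} limit 0<γ c partite =
  clash {λ n → co⁺ex n F} (positive-limit {λ n → co⁺ex n F} {γ} limit 0<γ) (co⁺ex-partite F partite)
  where
  clash : ∀ {k : ℕ → ℕ} →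
    (∃ λ q → ∃ λ N → ∀ n → N ≤ n → 1 ≤ n → n < suc q * k n) →
    ¬ (∀ q → ∃ λ N → ∀ n → N ≤ n → 1 ≤ n → suc q * k n < n)
  clash (q , N , large) eventually-small with eventually-small q
  ... | N′ , small = ℕ.<-asym
    (large n (ℕ.m≤n⇒m≤1+n (ℕ.m≤m⊔n N N′)) (s≤s z≤n))
    (small n (ℕ.m≤n⇒m≤1+n (ℕ.m≤n⊔m N N′)) (s≤s z≤n))
    where
    -- Past both thresholds, and the successor keeps `n` positive.
    n = suc (N ⊔ N′)

-- Multiples of `r` suffice: a limit below `1 / r` would force `co⁺ex n F * r < n` for all large
-- `n`, against the construction at `n = r * m`.
nonpartite⇒density≥1/r : ∀ {r v} (F : RGraph r v) {γ} → 1 ≤ r →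
  IsPositiveCodegreeDensity F γ → (∀ c → ¬ IsPartite F c) → fromℚ (1 ÷ r) ≤ℝ γ
nonpartite⇒density≥1/r {r} F {γ} 1≤r limit ¬partite γ<1/r =
  clash {λ n → co⁺ex n F} (limit-below-unit-fraction {λ n → co⁺ex n F} {γ} limit 1≤r γ<1/r)
        (λ m → co⁺ex-nonpartite m F 1≤r ¬partite)
  where
  instance _ = >-nonZero 1≤r
  clash : ∀ {k : ℕ → ℕ} → (∃ λ N → ∀ n → N ≤ n → 1 ≤ n → k n * r < n) →
          ¬ (∀ m → m ≤ k (r * m))
  clash (N , small) large = ℕ.<⇒≱
    (small (r * m) (ℕ.≤-trans (ℕ.n≤1+n N) (ℕ.m≤n*m m r)) (ℕ.*-mono-≤ 1≤r (s≤s (z≤n {N}))))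
    (ℕ.≤-trans (ℕ.≤-reflexive (ℕ.*-comm r m)) (ℕ.*-monoˡ-≤ r (large m)))
    where
    m = suc N

corollary27 : ∀ (r : ℕ) → 2 ≤ r → ∀ {v : ℕ} (F : RGraph r v) (γ : ℝ) →
    IsPositiveCodegreeDensity F γ →
    0ℝ <ℝ γ → fromℚ (1 ÷ r) ≤ℝ γ
corollary27 r 2≤r F γ limit 0<γ =
  nonpartite⇒density≥1/r F {γ} (ℕ.<⇒≤ 2≤r) limit
    (positive-density⇒nonpartite F {γ} limit 0<γ)
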